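{- A finite simple graph $G$ belongs to $\mathcal{G}_2^*$ if and only if $G\cong K_2$, or $G$ is connected and can be obtained from $K_1$ by iteratively anchoring stars.
   Context: A finite topology $\tau$ on a finite set $X$ is a family of subsets of $X$ (the open sets) containing $\emptyset$ and $X$ and closed under unions and intersections. Distinct $x,y\in X$ are $T_2$-separated if there exist disjoint open sets $U_x\ni x$ and $U_y\ni y$. $G_2(\tau)$ is the simple graph with vertex set $X$ in which distinct $x,y$ are adjacent iff they are not $T_2$-separated, and $\mathcal{G}_2$ is the class of graphs isomorphic to $G_2(\tau)$ for some finite topology $\tau$. A graph $G$ is $\mathcal{G}_2$-critical, written $G\in\mathcal{G}_2^*$, if $G\in\mathcal{G}_2$ and for every nonempty set $S\subseteq E(G)$, the graph $G-S$ is either disconnected or not in $\mathcal{G}_2$. Anchoring a star to a graph $G$ means adding a new star $K_{1,t}$ ($t\ge1$) with center $x$ and joining $x$ by edges to every vertex of some maximal clique of $G$.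
   Formalization: As defined, every disconnected graph in 𝒢₂ (e.g. two isolated vertices) is vacuously 𝒢₂-critical, so the literal claim fails; the formal theorem characterizes the connected members of 𝒢₂*, with the null graph counted as not connected. -}

module Defs where

open import Data.Fin using (Fin; zero)
open import Data.Fin.Properties using (_≟_)
open import Data.Fin.Subset using (Subset; _∈_; _⊆_; _∪_; _∩_; ⊤; ⊥; Empty)
open import Data.Fin.Subset.Properties using (_∈?_; anySubset?; nonempty?; ∩-comm)
open import Data.Nat using (ℕ; _≤_)
import Data.Nat as ℕ
open import Data.Product using (Σ; ∃-syntax; _×_; _,_)
open import Data.Sum using (_⊎_; inj₁; inj₂)
open import Function using (_↔_; _⇔_; Inverse)
open import Level using (0ℓ)
open import Relation.Binary using (Rel; Decidable; Symmetric; Irreflexive)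
open import Relation.Binary.Construct.Closure.ReflexiveTransitive using (Star)
open import Relation.Binary.PropositionalEquality using (_≡_; _≢_; refl; sym; subst)
open import Relation.Nullary using (¬_)
open import Relation.Nullary.Decidable using (¬?; _×-dec_; _⊎-dec_)
open import Relation.Unary using (Pred)
import Relation.Unary as U

-- Adjacency is decidable because only finite graphs, given by explicit data,
-- are considered.
record Graph (V : Set) : Set₁ where
  field
    Adj        : Rel V 0ℓ
    Adj?       : Decidable Adj
    Adj-sym    : Symmetric Adj
    Adj-irrefl : Irreflexive _≡_ Adj

open Graph public

infix 4 _≅_

_≅_ : {V W : Set} → Graph V → Graph W → Set
_≅_ {V} {W} G H =
  Σ (V ↔ W) λ f → ∀ x y → Adj G x y ⇔ Adj H (Inverse.to f x) (Inverse.to f y)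

-- The null graph is not connected.
Connected : {V : Set} → Graph V → Set
Connected {V} G = V × (∀ x y → Star (Adj G) x y)

complete : ∀ n → Graph (Fin n)
complete n = record
  { Adj        = _≢_
  ; Adj?       = λ x y → ¬? (x ≟ y)
  ; Adj-sym    = λ x≢y y≡x → x≢y (sym y≡x)
  ; Adj-irrefl = λ x≡y x≢y → x≢y x≡y
  }

K₁ : Graph (Fin 1)
K₁ = complete 1

K₂ : Graph (Fin 2)
K₂ = complete 2

-- On a finite set, closure under binary unions and intersections amounts to
-- closure under arbitrary ones.
record Topology (n : ℕ) : Set₁ where
  field
    Open   : Pred (Subset n) 0ℓ
    Open?  : U.Decidable Open
    ⊥-open : Open ⊥
    ⊤-open : Open ⊤
    ∪-open : ∀ {A B} → Open A → Open B → Open (A ∪ B)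
    ∩-open : ∀ {A B} → Open A → Open B → Open (A ∩ B)

module _ {n : ℕ} (τ : Topology n) where
  open Topology τ

  T₂-Separated : Rel (Fin n) 0ℓ
  T₂-Separated x y =
    ∃[ A ] ∃[ B ] (Open A × Open B × x ∈ A × y ∈ B × Empty (A ∩ B))

  T₂-separated? : Decidable T₂-Separated
  T₂-separated? x y = anySubset? λ A → anySubset? λ B →
    Open? A ×-dec Open? B ×-dec (x ∈? A) ×-dec (y ∈? B) ×-dec ¬? (nonempty? (A ∩ B))

  T₂-sym : Symmetric T₂-Separated
  T₂-sym (A , B , oA , oB , x∈A , y∈B , disj) =
    B , A , oB , oA , y∈B , x∈A , subst Empty (∩-comm A B) disj

  G₂ : Graph (Fin n)
  G₂ = record
    { Adj        = λ x y → x ≢ y × ¬ T₂-Separated x y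
    ; Adj?       = λ x y → ¬? (x ≟ y) ×-dec ¬? (T₂-separated? x y)
    ; Adj-sym    = λ (x≢y , ns) → (λ y≡x → x≢y (sym y≡x)) , (λ s → ns (T₂-sym s))
    ; Adj-irrefl = λ x≡y (x≢y , _) → x≢y x≡y
    }

In𝒢₂ : {V : Set} → Graph V → Set₁
In𝒢₂ G = ∃[ n ] Σ (Topology n) λ τ → G ≅ G₂ τ

-- A set of (unordered) edges of G, as a symmetric relation contained in Adj G.
record EdgeSet {V : Set} (G : Graph V) : Set₁ where
  field
    Mem     : Rel V 0ℓ
    Mem?    : Decidable Mem
    Mem-sym : Symmetric Mem
    Mem⊆Adj : ∀ {x y} → Mem x y → Adj G x y

open EdgeSet public

NonemptyEdges : {V : Set} {G : Graph V} → EdgeSet G → Set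
NonemptyEdges S = ∃[ x ] ∃[ y ] Mem S x y

infixl 6 _─_

_─_ : {V : Set} (G : Graph V) → EdgeSet G → Graph V
G ─ S = record
  { Adj        = λ x y → Adj G x y × ¬ Mem S x y
  ; Adj?       = λ x y → Adj? G x y ×-dec ¬? (Mem? S x y)
  ; Adj-sym    = λ (a , ns) → Adj-sym G a , (λ s → ns (Mem-sym S s))
  ; Adj-irrefl = λ x≡y (a , _) → Adj-irrefl G x≡y a
  }

-- Every graph in 𝒢₂ that is disconnected is vacuously critical in this sense,
-- e.g. two isolated vertices.
Critical : {V : Set} → Graph V → Set₁
Critical G =
  In𝒢₂ G × ((S : EdgeSet G) → NonemptyEdges S → ¬ Connected (G ─ S) ⊎ ¬ In𝒢₂ (G ─ S))

IsClique : ∀ {n} → Graph (Fin n) → Subset n → Set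
IsClique G Q = ∀ {u v} → u ∈ Q → v ∈ Q → u ≢ v → Adj G u v

IsMaximalClique : ∀ {n} → Graph (Fin n) → Subset n → Set
IsMaximalClique G Q = IsClique G Q × (∀ R → IsClique G R → Q ⊆ R → R ⊆ Q)

-- K_{1,t} with centre zero.
star : ∀ t → Graph (Fin (ℕ.suc t))
star t = record
  { Adj        = λ a b → (a ≡ zero × b ≢ zero) ⊎ (a ≢ zero × b ≡ zero)
  ; Adj?       = λ a b → ((a ≟ zero) ×-dec ¬? (b ≟ zero)) ⊎-dec (¬? (a ≟ zero) ×-dec (b ≟ zero))
  ; Adj-sym    = λ { (inj₁ (p , q)) → inj₂ (q , p) ; (inj₂ (p , q)) → inj₁ (q , p) }
  ; Adj-irrefl = λ { refl (inj₁ (p , q)) → q p ; refl (inj₂ (p , q)) → p q }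
  }

module _ {n : ℕ} (G : Graph (Fin n)) (Q : Subset n) (t : ℕ) where

  -- Disjoint union of G and star t, with the centre of the star joined to Q.
  AnchorAdj : Rel (Fin n ⊎ Fin (ℕ.suc t)) 0ℓ
  AnchorAdj (inj₁ u) (inj₁ v) = Adj G u v
  AnchorAdj (inj₁ u) (inj₂ b) = u ∈ Q × b ≡ zero
  AnchorAdj (inj₂ a) (inj₁ v) = v ∈ Q × a ≡ zero
  AnchorAdj (inj₂ a) (inj₂ b) = Adj (star t) a b

  anchor : Graph (Fin n ⊎ Fin (ℕ.suc t))
  anchor = record
    { Adj        = AnchorAdj
    ; Adj?       = dec
    ; Adj-sym    = λ {x} {y} → symm x y
    ; Adj-irrefl = λ { {x} refl → irr x }
    }
    where
    dec : Decidable AnchorAdj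
    dec (inj₁ u) (inj₁ v) = Adj? G u v
    dec (inj₁ u) (inj₂ b) = (u ∈? Q) ×-dec (b ≟ zero)
    dec (inj₂ a) (inj₁ v) = (v ∈? Q) ×-dec (a ≟ zero)
    dec (inj₂ a) (inj₂ b) = Adj? (star t) a b

    symm : ∀ x y → AnchorAdj x y → AnchorAdj y x
    symm (inj₁ u) (inj₁ v) p = Adj-sym G p
    symm (inj₁ u) (inj₂ b) p = p
    symm (inj₂ a) (inj₁ v) p = p
    symm (inj₂ a) (inj₂ b) p = Adj-sym (star t) p

    irr : ∀ x → ¬ AnchorAdj x x
    irr (inj₁ u) = Adj-irrefl G refl
    irr (inj₂ a) = Adj-irrefl (star t) refl

-- Graphs obtained, up to isomorphism, from K₁ by zero or more anchorings.
data FromK₁ : ∀ {n} → Graph (Fin n) → Set₁ where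
  start : ∀ {n} {G : Graph (Fin n)} → G ≅ K₁ → FromK₁ G
  step  : ∀ {m n} {G : Graph (Fin m)} {H : Graph (Fin n)} →
          FromK₁ G →
          (Q : Subset m) → IsMaximalClique G Q →
          (t : ℕ) → 1 ≤ t →
          H ≅ anchor G Q t →
          FromK₁ H

{-# OPTIONS --safe #-}
module Submission where

-- A finite topology is a preorder, and two points fail to be T₂-separated iff both lie
-- near a common point of a minimal open set. Such points are simplicial, so 𝒢₂ consists
-- of the graphs in which every vertex and every edge lies in the closed neighbourhood of
-- some simplicial vertex. A connected graph of this kind other than K₂ is critical iff the
-- incidences between its simplicial neighbourhoods and its other vertices form a tree with
-- exactly one simplicial vertex per neighbourhood: distinct simplicial vertices are not
-- adjacent (Thin), and each vertex separates its simplicial neighbours from each other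
-- (Separating). Otherwise edges can be deleted while staying connected and in 𝒢₂. Growing
-- that tree one non-simplicial vertex at a time, together with its new simplicial
-- neighbours, is the same as anchoring stars.

open import Defs
import Data.Empty as Empty
open import Data.Fin using (Fin; zero; suc; splitAt; join)
open import Data.Fin.Properties
  using (_≟_; all?; any?; ¬∀⟶∃¬; +↔⊎; splitAt-join; injective⇒≤)
open import Data.Fin.Subset
  using (Subset; _∈_; _⊆_; _∪_; _∩_; _⊂_; ⁅_⁆; ⊤; Nonempty)
open import Data.Fin.Subset.Induction using (⊂-wellFounded)
open import Data.Fin.Subset.Properties
  using (_∈?_; _⊆?_; anySubset?; nonempty?; ∈⊤; ∉⊥; x∈p∩q⁺; x∈p∩q⁻; x∈p∪q⁺; x∈p∪q⁻;
         p∩q⊆p; p∩q⊆q; x∈⁅x⁆; x∈⁅y⁆⇒x≡y)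
import Data.List as List
open import Data.List using (List; _∷_)
open import Data.List.Membership.Propositional.Properties
  using (∈-filter⁺; ∈-filter⁻; ∈-lookup; ∈-allFin; ∈-length)
import Data.List.Relation.Unary.All as All
open import Data.List.Relation.Unary.AllPairs using (_∷_)
import Data.List.Relation.Unary.Any as Any
open import Data.List.Relation.Unary.Any.Properties using (lookup-index)
open import Data.List.Relation.Unary.Unique.Propositional using (Unique)
open import Data.List.Relation.Unary.Unique.Propositional.Properties using (filter⁺; allFin⁺)
open import Data.Maybe using (Maybe; just; nothing)
open import Data.Nat using (ℕ; suc; zero; _+_; _≤_; s≤s)
open import Data.Nat.Properties
  using (m≤n+m; ≤-trans; ≤-reflexive; +-identityʳ; +-monoʳ-≤; +-assoc; m+1+n≰m)
open import Data.Product using (Σ; ∃-syntax; _×_; _,_; proj₁; proj₂)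
open import Data.Sum using (_⊎_; inj₁; inj₂; [_,_]′)
import Data.Sum as Sum
open import Data.Sum.Properties using (inj₁-injective)
open import Data.Vec using (tabulate)
open import Data.Vec.Properties using (lookup∘tabulate; lookup⇒[]=; []=⇒lookup)
open import Function
  using (Injection; _⇔_; _↔_; _∘_; id; Equivalence; Inverse; mk⇔; mk↔ₛ′)
open import Function.Construct.Composition using (_↔-∘_)
open import Function.Construct.Identity using (↔-id)
open import Function.Properties.Inverse using (↔⇒↣)
open import Induction.WellFounded using (Acc; acc)
open import Level using (0ℓ)
open import Relation.Binary using (Rel; Decidable)
open import Relation.Binary.Construct.Closure.ReflexiveTransitive
  using (Star; ε; _◅_; _◅◅_; gmap; kleisliStar; return; reverse)
import Relation.Binary.Construct.Closure.ReflexiveTransitive as Star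
open import Relation.Binary.PropositionalEquality
  using (_≡_; _≢_; refl; sym; trans; cong; subst; subst₂; ≢-sym)
open import Relation.Nullary using (¬_; Dec; yes; no; contradiction; does)
open import Relation.Nullary.Decidable
  using (¬?; _×-dec_; _⊎-dec_; _→-dec_; decidable-stable; dec-true)
open import Relation.Unary using (Pred)
import Relation.Unary as U

private
  variable
    m n : ℕ
    V W : Set

-- Closed neighbourhoods and simplicial vertices

module _ (G : Graph V) where

  Near : Rel V 0ℓ
  Near x y = x ≡ y ⊎ Adj G x y

  Simplicial : V → Set
  Simplicial z = ∀ u v → Near z u → Near z v → Near u v

  -- Adjacency in `G` minus `x`, kept on the same vertex type; between other vertices,
  -- `Star (Avoiding x)` is reachability off `x`.
  Avoiding : V → Rel V 0ℓ
  Avoiding x a b = Adj G a b × a ≢ x × b ≢ x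

  -- The combinatorial form of membership in 𝒢₂. With `Near` in place of `Adj`, the case `x ≡ y`
  -- takes care of the single vertices.
  Covered : Set
  Covered = ∀ x y → Near x y → ∃[ z ] (Simplicial z × Near z x × Near z y)

  -- The Helly-type strengthening of Covered from edges to all cliques.
  CliqueCovered : Set₁
  CliqueCovered = (P : V → Set) → U.Decidable P → (∀ u v → P u → P v → Near u v) →
    ∃[ z ] (Simplicial z × (∀ u → P u → Near z u))

  Thin : Set
  Thin = ∀ z w → Simplicial z → Simplicial w → Near z w → z ≡ w

  Separating : Set
  Separating = ∀ x z w → Simplicial z → Simplicial w → Adj G x z → Adj G x w →
    Star (Avoiding x) z w → z ≡ w

  Near-sym : ∀ {x y} → Near x y → Near y x
  Near-sym = Sum.map sym (Adj-sym G)

  Near⇒Adj : ∀ {x y} → Near x y → x ≢ y → Adj G x y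
  Near⇒Adj (inj₁ x≡y) x≢y = contradiction x≡y x≢y
  Near⇒Adj (inj₂ a)   _   = a

  Adj⇒≢ : ∀ {x y} → Adj G x y → x ≢ y
  Adj⇒≢ a x≡y = Adj-irrefl G x≡y a

  Near⇒Star : ∀ {x y} → Near x y → Star (Adj G) x y
  Near⇒Star (inj₁ refl) = ε
  Near⇒Star (inj₂ a)    = return a

  Near⇒Avoiding : ∀ {x a b} → Near a b → a ≢ x → b ≢ x → Star (Avoiding x) a b
  Near⇒Avoiding (inj₁ refl) _   _   = ε
  Near⇒Avoiding (inj₂ a)    a≢x b≢x = return (a , a≢x , b≢x)

  Avoiding-sym : ∀ {x a b} → Avoiding x a b → Avoiding x b a
  Avoiding-sym (a , p , q) = Adj-sym G a , q , p

module _ (G : Graph (Fin n)) where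

  Near? : Decidable (Near G)
  Near? x y = (x ≟ y) ⊎-dec Adj? G x y

  Simplicial? : U.Decidable (Simplicial G)
  Simplicial? z = all? λ u → all? λ v → Near? z u →-dec Near? z v →-dec Near? u v

  Covered? : Dec (Covered G)
  Covered? = all? λ x → all? λ y → Near? x y →-dec
    any? λ z → Simplicial? z ×-dec Near? z x ×-dec Near? z y

  ¬Simplicial⇒ : ∀ {x} → ¬ Simplicial G x →
    ∃[ u ] ∃[ v ] (Near G x u × Near G x v × ¬ Near G u v)
  ¬Simplicial⇒ {x} ¬s
    with any? (λ u → any? λ v → Near? x u ×-dec Near? x v ×-dec ¬? (Near? u v))
  ... | yes (u , v , p) = u , v , p
  ... | no none = contradiction
    (λ u v p q → decidable-stable (Near? u v) λ r → none (u , v , p , q , r)) ¬s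

  -- Take two vertices near `x` but not near each other. One simplicial vertex cannot cover both
  -- pairs formed with `x`, since it would make the two near each other.
  ¬Simplicial⇒two : Covered G → ∀ {x} → ¬ Simplicial G x →
    ∃[ z ] ∃[ w ] (Simplicial G z × Simplicial G w × Adj G x z × Adj G x w × z ≢ w)
  ¬Simplicial⇒two cov {x} ¬s with ¬Simplicial⇒ ¬s
  ... | u , v , xu , xv , ¬uv with cov x u xu | cov x v xv
  ... | z , sz , zx , zu | w , sw , wx , wv =
    z , w , sz , sw , adj sz zx , adj sw wx , λ { refl → ¬uv (sz u v zu wv) }
    where
    adj : ∀ {z} → Simplicial G z → Near G z x → Adj G x z
    adj sz zx = Near⇒Adj G (Near-sym G zx) λ { refl → ¬s sz }

-- Invariance under isomorphism

≅-trans : {U V W : Set} (F : Graph U) (G : Graph V) (H : Graph W) → F ≅ G → G ≅ H → F ≅ H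
≅-trans _ _ _ (f , e) (g , d) = g ↔-∘ f , λ x y → mk⇔
  (Equivalence.to (d _ _) ∘ Equivalence.to (e x y))
  (Equivalence.from (e x y) ∘ Equivalence.from (d _ _))

module Transport (G : Graph V) (H : Graph W) (iso : G ≅ H) where
  to   = Inverse.to (proj₁ iso)
  from = Inverse.from (proj₁ iso)

  to-from : ∀ y → to (from y) ≡ y
  to-from = Inverse.strictlyInverseˡ (proj₁ iso)

  from-to : ∀ x → from (to x) ≡ x
  from-to = Inverse.strictlyInverseʳ (proj₁ iso)

  to-injective : ∀ {x y} → to x ≡ to y → x ≡ y
  to-injective = Injection.injective (↔⇒↣ (proj₁ iso))

  Adj-to : ∀ {x y} → Adj G x y → Adj H (to x) (to y)
  Adj-to = Equivalence.to (proj₂ iso _ _)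

  Near-to : ∀ {x y} → Near G x y → Near H (to x) (to y)
  Near-to = Sum.map (cong to) Adj-to

  Near-from : ∀ {x y} → Near H (to x) (to y) → Near G x y
  Near-from = Sum.map to-injective (Equivalence.from (proj₂ iso _ _))

  Near-fromˡ : ∀ {x y} → Near H x (to y) → Near G (from x) y
  Near-fromˡ p = Near-from (subst (λ w → Near H w _) (sym (to-from _)) p)

  Near-toˡ : ∀ {x y} → Near G (from x) y → Near H x (to y)
  Near-toˡ p = subst (λ w → Near H w _) (to-from _) (Near-to p)

  Near-fromʳ : ∀ {x y} → Near H (to x) y → Near G x (from y)
  Near-fromʳ p = Near-from (subst (Near H _) (sym (to-from _)) p)

  Near-to₂ : ∀ {x y} → Near G (from x) (from y) → Near H x y
  Near-to₂ p = subst (Near H _) (to-from _) (Near-toˡ p)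

  Simplicial-to : ∀ {z} → Simplicial G z → Simplicial H (to z)
  Simplicial-to sz u v p q = Near-to₂ (sz (from u) (from v) (Near-fromʳ p) (Near-fromʳ q))

  Simplicial-from : ∀ {z} → Simplicial H z → Simplicial G (from z)
  Simplicial-from sz u v p q = Near-from (sz (to u) (to v) (Near-toˡ p) (Near-toˡ q))

  Covered-from : Covered H → Covered G
  Covered-from cov x y xy with cov (to x) (to y) (Near-to xy)
  ... | z , sz , zx , zy = from z , Simplicial-from sz , Near-fromˡ zx , Near-fromˡ zy

  CliqueCovered-from : CliqueCovered H → CliqueCovered G
  CliqueCovered-from cov P P? cl
    with cov (P ∘ from) (P? ∘ from) (λ u v p q → Near-to₂ (cl _ _ p q))
  ... | z , sz , near = from z , Simplicial-from sz ,
    λ u p → Near-fromˡ (near (to u) (subst P (sym (from-to u)) p))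

  Thin-from : Thin H → Thin G
  Thin-from thin z w sz sw zw =
    to-injective (thin (to z) (to w) (Simplicial-to sz) (Simplicial-to sw) (Near-to zw))

  Separating-from : Separating H → Separating G
  Separating-from sep x z w sz sw xz xw p = to-injective
    (sep (to x) (to z) (to w) (Simplicial-to sz) (Simplicial-to sw) (Adj-to xz) (Adj-to xw)
      (gmap to (λ (a , b , c) → Adj-to a , b ∘ to-injective , c ∘ to-injective) p))

-- Finite topologies

module _ {P : Pred (Fin n) 0ℓ} (P? : U.Decidable P) where

  ⟦_⟧ : Subset n
  ⟦_⟧ = tabulate (does ∘ P?)

  ∈⟦⟧⁺ : ∀ {x} → P x → x ∈ ⟦_⟧
  ∈⟦⟧⁺ {x} p = lookup⇒[]= x _ (trans (lookup∘tabulate _ x) (dec-true (P? x) p))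

  ∈⟦⟧⁻ : ∀ {x} → x ∈ ⟦_⟧ → P x
  ∈⟦⟧⁻ {x} x∈ with P? x | trans (sym (lookup∘tabulate (does ∘ P?) x)) ([]=⇒lookup x∈)
  ... | yes p | _ = p
  ... | no _  | ()

minimal-subset : {P : Pred (Subset n) 0ℓ} → U.Decidable P → ∀ A → P A →
  ∃[ M ] (P M × (∀ B → P B → B ⊆ M → M ⊆ B))
minimal-subset {n} {P} P? A = go A (⊂-wellFounded A)
  where
  go : ∀ A → Acc _⊂_ A → P A → ∃[ M ] (P M × (∀ B → P B → B ⊆ M → M ⊆ B))
  go A (acc smaller) pA with anySubset? (λ B → P? B ×-dec (B ⊆? A) ×-dec ¬? (A ⊆? B))
  ... | no none = A , pA , λ B pB B⊆A → decidable-stable (A ⊆? B) λ A⊈B → none (B , pB , B⊆A , A⊈B)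
  ... | yes (B , pB , B⊆A , A⊈B) = go B (smaller (B⊆A , witness)) pB
    where
    witness : ∃[ x ] (x ∈ A × ¬ x ∈ B)
    witness with any? (λ x → (x ∈? A) ×-dec ¬? (x ∈? B))
    ... | yes w = w
    ... | no none = contradiction
      (λ {x} x∈A → decidable-stable (x ∈? B) λ x∉B → none (x , x∈A , x∉B)) A⊈B

module _ (τ : Topology n) where
  open Topology τ

  ¬Separated⇒Near : ∀ {x y} → ¬ T₂-Separated τ x y → Near (G₂ τ) x y
  ¬Separated⇒Near {x} {y} ns with x ≟ y
  ... | yes x≡y = inj₁ x≡y
  ... | no x≢y  = inj₂ (x≢y , ns)

  Near⇒¬Separated : ∀ {x y} → Near (G₂ τ) x y → ¬ T₂-Separated τ x y
  Near⇒¬Separated (inj₁ refl) (_ , _ , _ , _ , x∈A , x∈B , disj) = disj (_ , x∈p∩q⁺ (x∈A , x∈B))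
  Near⇒¬Separated (inj₂ (_ , ns)) = ns

  meets : ∀ {x y A B} → ¬ T₂-Separated τ x y → Open A → Open B → x ∈ A → y ∈ B → Nonempty (A ∩ B)
  meets {A = A} {B} ns oA oB x∈A y∈B =
    decidable-stable (nonempty? (A ∩ B)) λ e → ns (A , B , oA , oB , x∈A , y∈B , e)

  -- A minimal open neighbourhood is least, since cutting it with any other one leaves an open
  -- neighbourhood inside it.
  least-nbhd : ∀ x → ∃[ U ] (Open U × x ∈ U × (∀ A → Open A → x ∈ A → U ⊆ A))
  least-nbhd x with minimal-subset (λ A → Open? A ×-dec (x ∈? A)) ⊤ (⊤-open , ∈⊤)
  ... | U , (oU , x∈U) , least = U , oU , x∈U , λ A oA x∈A u∈U →
    p∩q⊆q U A (least (U ∩ A) (∩-open oU oA , x∈p∩q⁺ (x∈U , x∈A)) (p∩q⊆p U A) u∈U)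

  -- Every point of a minimal nonempty open set is simplicial.
  G₂-covered : Covered (G₂ τ)
  G₂-covered x y xy with least-nbhd x | least-nbhd y
  ... | U , oU , x∈U , leastU | U′ , oU′ , y∈U′ , leastU′
    -- The least neighbourhoods of `x` and `y` meet, as nothing separates these points; any point of
    -- a minimal nonempty open set inside the intersection covers both.
    with minimal-subset {P = λ A → Open A × Nonempty A × A ⊆ U ∩ U′}
           (λ A → Open? A ×-dec nonempty? A ×-dec (A ⊆? U ∩ U′))
           (U ∩ U′) (∩-open oU oU′ , meets (Near⇒¬Separated xy) oU oU′ x∈U y∈U′ , id)
  ... | M , (oM , (z , z∈M) , M⊆U∩U′) , minimal =
    z , simplicial , near (λ A oA x∈A → leastU A oA x∈A ∘ p∩q⊆p U U′ ∘ M⊆U∩U′)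
                   , near (λ A oA y∈A → leastU′ A oA y∈A ∘ p∩q⊆q U U′ ∘ M⊆U∩U′)
    where
    near : ∀ {v} → (∀ A → Open A → v ∈ A → M ⊆ A) → Near (G₂ τ) z v
    near least = ¬Separated⇒Near λ (A , B , _ , oB , z∈A , v∈B , disj) →
      disj (z , x∈p∩q⁺ (z∈A , least B oB v∈B z∈M))

    -- Every open set around such a `v` meets `M`, hence contains it by minimality.
    above : ∀ {v} → Near (G₂ τ) z v → ∀ A → Open A → v ∈ A → M ⊆ A
    above zv A oA v∈A u∈M = p∩q⊆q M A (minimal (M ∩ A)
      (∩-open oM oA , meets (Near⇒¬Separated zv) oM oA z∈M v∈A , M⊆U∩U′ ∘ p∩q⊆p M A)
      (p∩q⊆p M A) u∈M)

    simplicial : Simplicial (G₂ τ) z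
    simplicial u v zu zv = ¬Separated⇒Near λ (A , B , oA , oB , u∈A , v∈B , disj) →
      disj (z , x∈p∩q⁺ (above zu A oA u∈A z∈M , above zv B oB v∈B z∈M))

In𝒢₂⇒Covered : (G : Graph V) → In𝒢₂ G → Covered G
In𝒢₂⇒Covered G (_ , τ , iso) = Transport.Covered-from G (G₂ τ) iso (G₂-covered τ)

module _ (G : Graph (Fin n)) where

  -- The open sets are the lower sets of the preorder in which each simplicial vertex lies below
  -- everything near it.
  Closed : Pred (Subset n) 0ℓ
  Closed A = ∀ x z → x ∈ A → Simplicial G z → Near G z x → z ∈ A

  simplicialTopology : Topology n
  simplicialTopology = record
    { Open   = Closed
    ; Open?  = λ A → all? λ x → all? λ z →
                 (x ∈? A) →-dec Simplicial? G z →-dec Near? G z x →-dec (z ∈? A)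
    ; ⊥-open = λ _ _ x∈ → contradiction x∈ ∉⊥
    ; ⊤-open = λ _ _ _ _ _ → ∈⊤
    ; ∪-open = λ {A} {B} oA oB x z x∈ sz zx → x∈p∪q⁺
        (Sum.map (λ p → oA x z p sz zx) (λ p → oB x z p sz zx) (x∈p∪q⁻ A B x∈))
    ; ∩-open = λ {A} {B} oA oB x z x∈ sz zx → let p , q = x∈p∩q⁻ A B x∈ in
        x∈p∩q⁺ (oA x z p sz zx , oB x z q sz zx)
    }

  private
    -- The least open set around `x`. One step down suffices, because a vertex near a simplicial `w`
    -- is near everything that `w` is near.
    InNbhd : Fin n → Pred (Fin n) 0ℓ
    InNbhd x w = w ≡ x ⊎ (Simplicial G w × Near G w x)

    InNbhd? : ∀ x → U.Decidable (InNbhd x)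
    InNbhd? x w = (w ≟ x) ⊎-dec (Simplicial? G w ×-dec Near? G w x)

    nbhd : Fin n → Subset n
    nbhd x = ⟦ InNbhd? x ⟧

    nbhd-closed : ∀ x → Closed (nbhd x)
    nbhd-closed x w z w∈ sz zw with ∈⟦⟧⁻ (InNbhd? x) w∈
    ... | inj₁ refl      = ∈⟦⟧⁺ (InNbhd? x) (inj₂ (sz , zw))
    ... | inj₂ (sw , wx) = ∈⟦⟧⁺ (InNbhd? x) (inj₂ (sz , sw z x (Near-sym G zw) wx))

    common : ∀ {x y w} → InNbhd x w → InNbhd y w → Near G x y
    common (inj₁ refl)      (inj₁ refl)     = inj₁ refl
    common (inj₁ refl)      (inj₂ (_ , wy)) = wy
    common (inj₂ (_ , wx))  (inj₁ refl)     = Near-sym G wx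
    common (inj₂ (sw , wx)) (inj₂ (_ , wy)) = sw _ _ wx wy

  Covered⇒In𝒢₂ : Covered G → In𝒢₂ G
  Covered⇒In𝒢₂ cov = n , simplicialTopology , ↔-id _ , λ x y → mk⇔ (unseparated x y) (adjacent x y)
    where
    unseparated : ∀ x y → Adj G x y → Adj (G₂ simplicialTopology) x y
    unseparated x y a = Adj⇒≢ G a , λ (A , B , oA , oB , x∈A , y∈B , disj) →
      let z , sz , zx , zy = cov x y (inj₂ a) in
      disj (z , x∈p∩q⁺ (oA x z x∈A sz zx , oB y z y∈B sz zy))

    adjacent : ∀ x y → Adj (G₂ simplicialTopology) x y → Adj G x y
    adjacent x y (x≢y , ns) with nonempty? (nbhd x ∩ nbhd y)
    ... | yes (w , w∈) = let p , q = x∈p∩q⁻ (nbhd x) (nbhd y) w∈ in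
      Near⇒Adj G (common (∈⟦⟧⁻ (InNbhd? x) p) (∈⟦⟧⁻ (InNbhd? y) q)) x≢y
    ... | no e = contradiction
      (nbhd x , nbhd y , nbhd-closed x , nbhd-closed y ,
       ∈⟦⟧⁺ (InNbhd? x) (inj₁ refl) , ∈⟦⟧⁺ (InNbhd? y) (inj₁ refl) , e) ns

-- Critical graphs

module _ (G : Graph (Fin n)) (c : Fin n) {P : Pred (Fin n) 0ℓ} (P? : U.Decidable P) where

  -- Both deletions used against criticality have this shape: they touch only edges at one vertex
  -- `c`.
  fan : EdgeSet G
  fan = record
    { Mem     = λ a b → Adj G a b × (a ≡ c × P b ⊎ b ≡ c × P a)
    ; Mem?    = λ a b → Adj? G a b ×-dec (((a ≟ c) ×-dec P? b) ⊎-dec ((b ≟ c) ×-dec P? a))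
    ; Mem-sym = λ (a , s) → Adj-sym G a , Sum.swap s
    ; Mem⊆Adj = proj₁
    }

  private
    H : Graph (Fin n)
    H = G ─ fan

  fan-keeps : ∀ {a b} → a ≢ c → b ≢ c → Adj G a b → Adj H a b
  fan-keeps a≢c b≢c a = a , λ { (_ , inj₁ (p , _)) → a≢c p ; (_ , inj₂ (p , _)) → b≢c p }

  fan-keeps-Near : ∀ {a b} → a ≢ c → b ≢ c → Near G a b → Near H a b
  fan-keeps-Near a≢c b≢c = Sum.map₂ (fan-keeps a≢c b≢c)

  fan-keeps-spoke : ∀ {u} → ¬ P u → Adj G c u → Adj H c u
  fan-keeps-spoke ¬p a = a ,
    λ { (_ , inj₁ (_ , p)) → ¬p p ; (_ , inj₂ (q , _)) → Adj-irrefl G (sym q) a }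

  fan-spoke : ∀ {u} → Adj H c u → ¬ P u
  fan-spoke (a , ¬s) p = ¬s (a , inj₁ (refl , p))

  -- Only the deleted spokes need a replacement walk, since every other edge survives.
  fan-connected : Connected G → (∀ {u} → Adj G c u → P u → Star (Adj H) c u) → Connected H
  fan-connected (v , walk) reroute = v , λ x y → kleisliStar id edge (walk x y)
    where
    spoke : ∀ {u} → Adj G c u → Star (Adj H) c u
    spoke {u} a with P? u
    ... | yes p = reroute a p
    ... | no ¬p = return (fan-keeps-spoke ¬p a)

    edge : ∀ {a b} → Adj G a b → Star (Adj H) a b
    edge {a} {b} e with a ≟ c | b ≟ c
    ... | yes refl | _        = spoke e
    ... | no _     | yes refl = reverse (Adj-sym H) (spoke (Adj-sym G e))
    ... | no a≢c   | no b≢c   = return (fan-keeps a≢c b≢c e)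

─-Near : {G : Graph V} (S : EdgeSet G) → ∀ {x y} → Near (G ─ S) x y → Near G x y
─-Near S = Sum.map₂ proj₁

module _ (G : Graph (Fin n)) (conn : Connected G) (crit : Critical G) where

  private
    cov : Covered G
    cov = In𝒢₂⇒Covered G (proj₁ crit)

    unremovable : (S : EdgeSet G) → NonemptyEdges S → Connected (G ─ S) → ¬ Covered (G ─ S)
    unremovable S ne conn′ cov′ with proj₂ crit S ne
    ... | inj₁ ¬conn = ¬conn conn′
    ... | inj₂ ¬in   = ¬in (Covered⇒In𝒢₂ (G ─ S) cov′)

  -- Given adjacent simplicial z and z′ with a third common neighbour w, the vertex z′
  -- can be made a leaf at w.
  module _ {z z′ w : Fin n} (sz : Simplicial G z) (sz′ : Simplicial G z′) (zz′ : Adj G z z′)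
           (zw : Adj G z w) (w≢z′ : w ≢ z′) where
    private
      ≢w? : U.Decidable (_≢ w)
      ≢w? u = ¬? (u ≟ w)

      S : EdgeSet G
      S = fan G z′ ≢w?

      H : Graph (Fin n)
      H = G ─ S

      z≢z′ : z ≢ z′
      z≢z′ = Adj⇒≢ G zz′

      z′w : Adj G z′ w
      z′w = Near⇒Adj G (sz _ _ (inj₂ zz′) (inj₂ zw)) (≢-sym w≢z′)

      nonempty : NonemptyEdges S
      nonempty = z , z′ , zz′ , inj₂ (refl , Adj⇒≢ G zw)

      kept-z′w : Adj H z′ w
      kept-z′w = fan-keeps-spoke G z′ ≢w? (λ w≢w → w≢w refl) z′w

      connected : Connected H
      -- A lost neighbour `u` of `z′` is reached through `w`: both are near the simplicial `z′`, so
      -- they are adjacent.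
      connected = fan-connected G z′ ≢w? conn λ {u} z′u u≢w →
        kept-z′w ◅ return (fan-keeps G z′ ≢w? w≢z′ (≢-sym (Adj⇒≢ G z′u))
          (Near⇒Adj G (sz′ _ _ (inj₂ z′w) (inj₂ z′u)) (≢-sym u≢w)))

      at-z′ : ∀ {u} → Near H z′ u → u ≡ z′ ⊎ u ≡ w
      at-z′ (inj₁ p) = inj₁ (sym p)
      at-z′ {u} (inj₂ a) = inj₂ (decidable-stable (u ≟ w) (fan-spoke G z′ ≢w? a))

      sz′-H : Simplicial H z′
      sz′-H u v p q with at-z′ p | at-z′ q
      ... | inj₁ refl | _         = q
      ... | inj₂ refl | inj₁ refl = Near-sym H p
      ... | inj₂ refl | inj₂ refl = inj₁ refl

      module _ {s} (ss : Simplicial G s) (s≢z′ : s ≢ z′) (s≢w : s ≢ w) where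

        avoids-z′ : ∀ {u} → Near H s u → u ≢ z′
        avoids-z′ su refl = [ s≢z′ , s≢w ]′ (at-z′ (Near-sym H su))

        simplicial-H : Simplicial H s
        simplicial-H u v p q = fan-keeps-Near G z′ ≢w? (avoids-z′ p) (avoids-z′ q)
          (ss u v (─-Near S p) (─-Near S q))

      -- If the given cover `s` is near `z′`, then `z` can replace it: whatever is near `s` is near
      -- `z′`, hence near `z`. Otherwise `s` is neither `z′` nor its neighbour `w`.
      better : ∀ {x y} → Near G x y →
        ∃[ s ] (Simplicial G s × s ≢ z′ × s ≢ w × Near G s x × Near G s y)
      better {x} {y} xy = let s , ss , sx , sy = cov x y xy in pick ss sx sy (Near? G s z′)
        where
        pick : ∀ {s} → Simplicial G s → Near G s x → Near G s y → Dec (Near G s z′) →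
          ∃[ s ] (Simplicial G s × s ≢ z′ × s ≢ w × Near G s x × Near G s y)
        pick ss sx sy (no ¬sz′) = _ , ss , (λ { refl → ¬sz′ (inj₁ refl) }) ,
          (λ { refl → ¬sz′ (inj₂ (Adj-sym G z′w)) }) , sx , sy
        pick {s} ss sx sy (yes sz′′) = z , sz , z≢z′ , Adj⇒≢ G zw , from-z sx , from-z sy
          where
          from-z : ∀ {u} → Near G s u → Near G z u
          from-z su = sz′ _ _ (inj₂ (Adj-sym G zz′)) (ss _ _ sz′′ su)

      covered : Covered H
      covered x y xy = go (x ≟ z′) (y ≟ z′)
        where
        go : Dec (x ≡ z′) → Dec (y ≡ z′) → ∃[ s ] (Simplicial H s × Near H s x × Near H s y)
        go (yes refl) _          = z′ , sz′-H , inj₁ refl , xy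
        go (no _)     (yes refl) = z′ , sz′-H , Near-sym H xy , inj₁ refl
        go (no x≢z′)  (no y≢z′)  =
          let s , ss , s≢z′ , s≢w , sx , sy = better (─-Near S xy) in
          s , simplicial-H ss s≢z′ s≢w ,
          fan-keeps-Near G z′ ≢w? s≢z′ x≢z′ sx , fan-keeps-Near G z′ ≢w? s≢z′ y≢z′ sy

    no-common-neighbour : Empty.⊥
    no-common-neighbour = unremovable S nonempty connected covered

  -- Two adjacent simplicial vertices have no common neighbour, so a walk starting at one of them
  -- never leaves the pair, and connectedness leaves no further vertex.
  critical⇒K₂⊎thin : G ≅ K₂ ⊎ Thin G
  critical⇒K₂⊎thin
    with any? (λ z → any? λ w → Simplicial? G z ×-dec Simplicial? G w ×-dec Adj? G z w)
  ... | no none = inj₂ λ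
    { z w sz sw (inj₁ z≡w) → z≡w
    ; z w sz sw (inj₂ zw)  → contradiction (z , w , sz , sw , zw) none }
  ... | yes (z , z′ , sz , sz′ , zz′) = inj₁ (mk↔ₛ′ to from to-from from-to , adj)
    where
    z≢z′ : z ≢ z′
    z≢z′ = Adj⇒≢ G zz′

    only : ∀ {u} → Near G z u → u ≡ z ⊎ u ≡ z′
    only (inj₁ p) = inj₁ (sym p)
    only {u} (inj₂ zu) = inj₂ (decidable-stable (u ≟ z′) (no-common-neighbour sz sz′ zz′ zu))

    reach : ∀ {u v} → Near G z u → Star (Adj G) u v → Near G z v
    reach zu ε = zu
    reach zu (uw ◅ p) with only zu
    ... | inj₁ refl = reach (inj₂ uw) p
    ... | inj₂ refl = reach (sz′ _ _ (inj₂ (Adj-sym G zz′)) (inj₂ uw)) p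

    all : ∀ u → u ≡ z ⊎ u ≡ z′
    all u = only (reach (inj₁ refl) (proj₂ conn z u))

    to : Fin _ → Fin 2
    to u = [ (λ _ → zero) , (λ _ → suc zero) ]′ (all u)

    from : Fin 2 → Fin _
    from zero       = z
    from (suc zero) = z′

    to-from : ∀ i → to (from i) ≡ i
    to-from zero with all z
    ... | inj₁ _ = refl
    ... | inj₂ p = contradiction p z≢z′
    to-from (suc zero) with all z′
    ... | inj₁ p = contradiction (sym p) z≢z′
    ... | inj₂ _ = refl

    from-to : ∀ u → from (to u) ≡ u
    from-to u with all u
    ... | inj₁ p = sym p
    ... | inj₂ p = sym p

    adj : ∀ x y → Adj G x y ⇔ to x ≢ to y
    adj x y = mk⇔ (λ a p → Adj-irrefl G (trans (sym (from-to x)) (trans (cong from p) (from-to y))) a) back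
      where
      back : to x ≢ to y → Adj G x y
      back ne with all x | all y
      ... | inj₁ refl | inj₁ refl = contradiction refl ne
      ... | inj₁ refl | inj₂ refl = zz′
      ... | inj₂ refl | inj₁ refl = Adj-sym G zz′
      ... | inj₂ refl | inj₂ refl = contradiction refl ne

  -- If z and w stay connected in G - x, then x can be detached from the clique around z.
  module _ (thin : Thin G) {x z w : Fin n} (sz : Simplicial G z) (sw : Simplicial G w)
           (xz : Adj G x z) (xw : Adj G x w) (walk : Star (Avoiding G x) z w) (z≢w : z ≢ w) where
    private
      Other : Fin n → Fin n → Set
      Other u s = Simplicial G s × s ≢ z × Near G s x × Near G s u

      Other? : ∀ u → Dec (∃[ s ] Other u s)
      Other? u = any? λ s → Simplicial? G s ×-dec ¬? (s ≟ z) ×-dec Near? G s x ×-dec Near? G s u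

      -- The far ends of the edges at `x` that only `z` covers; exactly these edges are deleted.
      Lost : Fin n → Set
      Lost u = Near G z u × ¬ (∃[ s ] Other u s)

      Lost? : U.Decidable Lost
      Lost? u = Near? G z u ×-dec ¬? (Other? u)

      S : EdgeSet G
      S = fan G x Lost?

      H : Graph (Fin n)
      H = G ─ S

      simplicial≢x : ∀ {s} → Simplicial G s → s ≢ x
      simplicial≢x ss refl = Adj⇒≢ G xz (thin _ _ ss sz (inj₂ xz))

      z-lost : Lost z
      z-lost = inj₁ refl , λ (s , ss , s≢z , _ , sz′) → s≢z (thin _ _ ss sz sz′)

      -- An edge at `x` inside the neighbourhood of `s` is covered by `s`, so it is not among the
      -- deleted ones.
      kept : ∀ {s a b} → Simplicial G s → s ≢ z → Near G s a → Near G s b → Near H a b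
      kept {s} {a} {b} ss s≢z sa sb = go (ss a b sa sb)
        where
        go : Near G a b → Near H a b
        go (inj₁ p) = inj₁ p
        go (inj₂ e) with a ≟ x | b ≟ x
        ... | yes refl | _ = inj₂ (fan-keeps-spoke G x Lost? (λ (_ , none) → none (s , ss , s≢z , sa , sb)) e)
        ... | no _ | yes refl = inj₂ (Adj-sym H {x} {a} (fan-keeps-spoke G x Lost?
          (λ (_ , none) → none (s , ss , s≢z , sb , sa)) (Adj-sym G e)))
        ... | no a≢x | no b≢x = inj₂ (fan-keeps G x Lost? a≢x b≢x e)

      kept-nbhd : ∀ {s a} → Simplicial G s → s ≢ z → Near G s a → Near H s a
      kept-nbhd ss s≢z sa = kept ss s≢z (inj₁ refl) sa

      simplicial-H : ∀ {s} → Simplicial G s → s ≢ z → Simplicial H s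
      simplicial-H ss s≢z u v p q = kept ss s≢z (─-Near S p) (─-Near S q)

      away : ∀ {a} → Near H z a → a ≢ x
      away p refl with Near-sym H p
      ... | inj₁ q = Adj⇒≢ G xz q
      ... | inj₂ a = fan-spoke G x Lost? a z-lost

      simplicial-H-z : Simplicial H z
      simplicial-H-z u v p q =
        fan-keeps-Near G x Lost? (away p) (away q) (sz u v (─-Near S p) (─-Near S q))

      connected : Connected H
      -- A lost `u` is reached from `x` by a detour: first to `w`, then off `x` back to `z`, then on
      -- to `u`.
      connected = fan-connected G x Lost? conn λ {u} xu (zu , _) →
        Near⇒Star H (Near-sym H (kept-nbhd sw (≢-sym z≢w) (inj₂ (Adj-sym G xw))))
        ◅◅ reverse (Adj-sym H) (Star.map (λ (e , p , q) → fan-keeps G x Lost? p q e) walk)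
        ◅◅ Near⇒Star H (fan-keeps-Near G x Lost? (simplicial≢x sz) (≢-sym (Adj⇒≢ G xu)) zu)

      -- Replaces `z`, which no longer covers pairs containing `x`. An edge from `x` to a neighbour
      -- of `z` survives only if another simplicial vertex covers it; for `x` alone, `w` serves.
      other : ∀ {b} → Near H x b → Near G z b → ∃[ s ] Other b s
      other (inj₁ refl) _  = w , sw , ≢-sym z≢w , inj₂ (Adj-sym G xw) , inj₂ (Adj-sym G xw)
      other {b} (inj₂ xb) zb = decidable-stable (Other? b) λ none →
        fan-spoke G x Lost? xb (zb , none)

      covered : Covered H
      covered a b ab = let s , ss , sa , sb = cov a b (─-Near S ab) in go ss sa sb (s ≟ z) (a ≟ x) (b ≟ x)
        where
        by : ∀ {s} → Simplicial G s → s ≢ z → Near G s a → Near G s b →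
          ∃[ s ] (Simplicial H s × Near H s a × Near H s b)
        by ss s≢z sa sb = _ , simplicial-H ss s≢z , kept-nbhd ss s≢z sa , kept-nbhd ss s≢z sb

        go : ∀ {s} → Simplicial G s → Near G s a → Near G s b → Dec (s ≡ z) → Dec (a ≡ x) →
          Dec (b ≡ x) → ∃[ s ] (Simplicial H s × Near H s a × Near H s b)
        go ss sa sb (no s≢z) _ _ = by ss s≢z sa sb
        go _ _ sb (yes refl) (yes refl) _ =
          let _ , ss , s≢z , sx , sb′ = other ab sb in by ss s≢z sx sb′
        go _ sa _ (yes refl) (no _) (yes refl) =
          let _ , ss , s≢z , sx , sa′ = other (Near-sym H ab) sa in by ss s≢z sa′ sx
        go _ sa sb (yes refl) (no a≢x) (no b≢x) =
          z , simplicial-H-z , fan-keeps-Near G x Lost? (simplicial≢x sz) a≢x sa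
                             , fan-keeps-Near G x Lost? (simplicial≢x sz) b≢x sb

    no-detour : Empty.⊥
    no-detour = unremovable S (x , z , xz , inj₁ (refl , z-lost)) connected covered

  critical⇒separating : Thin G → Separating G
  critical⇒separating thin x z w sz sw xz xw walk = decidable-stable (z ≟ w)
    (no-detour thin sz sw xz xw walk)

-- Tree-like graphs are critical

module _ (G : Graph (Fin n)) (conn : Connected G) (cov : Covered G) (thin : Thin G)
         (sep : Separating G) where

  -- A connected spanning subgraph that is again covered must be the whole graph: each
  -- non-simplicial vertex separates its simplicial neighbours, so the subgraph needs an
  -- edge into each of the parts, and covering that edge forces the original spokes.
  module _ (S : EdgeSet G) (conn′ : Connected (G ─ S)) (cov′ : Covered (G ─ S)) where
    private
      H : Graph (Fin n)
      H = G ─ S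

      -- The walk is cut at its first arrival at `x`, so the part before avoids `x`.
      last-step : ∀ {x z} → Star (Adj H) z x → z ≢ x →
        ∃[ u ] (Adj H u x × u ≢ x × Star (Avoiding G x) z u)
      last-step ε z≢x = contradiction refl z≢x
      last-step {x} (_◅_ {j = w} zw p) z≢x with w ≟ x
      ... | yes refl = _ , zw , z≢x , ε
      ... | no w≢x   = let u , ux , u≢x , q = last-step p w≢x in
        u , ux , u≢x , (proj₁ zw , z≢x , w≢x) ◅ q

      simplicial-nbr : ∀ {x z} → Simplicial G x → Simplicial G z → ¬ Adj G x z
      simplicial-nbr sx sz a = Adj⇒≢ G a (thin _ _ sx sz (inj₂ a))

    -- If `x` were not simplicial in `G`, it would have two simplicial neighbours there. Walks of
    -- `H` from them arrive at `x` through `u` and `v`, which are near each other as `x` is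
    -- simplicial in `H`; this joins the two off `x`, against `Separating`.
    simplicial-reflects : ∀ {x} → Simplicial H x → Simplicial G x
    simplicial-reflects {x} sx = decidable-stable (Simplicial? G x) λ ¬sx →
      let z , w , sz , sw , xz , xw , z≢w = ¬Simplicial⇒two G cov ¬sx
          u , ux , u≢x , p = last-step (proj₂ conn′ z x) (≢-sym (Adj⇒≢ G xz))
          v , vx , v≢x , q = last-step (proj₂ conn′ w x) (≢-sym (Adj⇒≢ G xw))
          uv = sx u v (inj₂ (Adj-sym H ux)) (inj₂ (Adj-sym H vx))
      in z≢w (sep x z w sz sw xz xw
           (p ◅◅ Near⇒Avoiding G (─-Near S uv) u≢x v≢x ◅◅ reverse (Avoiding-sym G) q))

    -- A walk of `H` from `z` arrives at `x` by some edge. The vertex `s` covering that edge in `H`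
    -- is joined to `z` off `x`, so `Separating` identifies it with `z`.
    spoke-kept : ∀ {x z} → Simplicial G z → Adj G x z → Adj H x z
    spoke-kept {x} {z} sz xz with last-step (proj₂ conn′ z x) (≢-sym (Adj⇒≢ G xz))
    ... | u , ux , u≢x , p with cov′ u x (inj₂ ux)
    ... | s , ss , su , sx = subst (Adj H x) (sym z≡s) xs
      where
      s≢x : s ≢ x
      s≢x refl = simplicial-nbr (simplicial-reflects ss) sz xz

      xs : Adj H x s
      xs = Near⇒Adj H (Near-sym H sx) (≢-sym s≢x)

      z≡s : z ≡ s
      z≡s = sep x z s sz (simplicial-reflects ss) xz (proj₁ xs)
        (p ◅◅ Near⇒Avoiding G (─-Near S (Near-sym H su)) u≢x s≢x)

    -- Whatever covers `z` in `H` is simplicial in `G` too, so by `Thin` it is `z` itself.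
    simplicial-preserved : ∀ {z} → Simplicial G z → Simplicial H z
    simplicial-preserved {z} sz with cov′ z z (inj₁ refl)
    ... | s , ss , sz′ , _ =
      subst (Simplicial H) (thin s z (simplicial-reflects ss) sz (─-Near S sz′)) ss

    -- The simplicial vertex covering the edge in `G` keeps its spokes and stays simplicial, which
    -- forces the edge.
    edge-kept : ∀ {a b} → Adj G a b → Adj H a b
    edge-kept {a} {b} ab with cov a b (inj₂ ab)
    ... | z , sz , za , zb =
      Near⇒Adj H (simplicial-preserved sz a b (kept za) (kept zb)) (Adj⇒≢ G ab)
      where
      kept : ∀ {u} → Near G z u → Near H z u
      kept (inj₁ p)  = inj₁ p
      kept (inj₂ zu) = inj₂ (Adj-sym H (spoke-kept sz (Adj-sym G zu)))

  treelike⇒critical : Critical G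
  treelike⇒critical = Covered⇒In𝒢₂ G cov , λ S ne → removal S ne
    where
    removal : (S : EdgeSet G) → NonemptyEdges S → ¬ Connected (G ─ S) ⊎ ¬ In𝒢₂ (G ─ S)
    removal S (a , b , ab) with Covered? (G ─ S)
    ... | no ¬cov = inj₂ (¬cov ∘ In𝒢₂⇒Covered (G ─ S))
    ... | yes cov′ = inj₁ λ conn′ → proj₂ (edge-kept S conn′ cov′ (Mem⊆Adj S ab)) ab

-- Anchoring

module _ (G : Graph (Fin m)) (clq : CliqueCovered G) (thin : Thin G) (sep : Separating G)
         (Q : Subset m) (max : IsMaximalClique G Q) (t : ℕ) where
  private
    -- The star has `suc t` leaves, so that `leaf zero` always exists.
    A : Graph (Fin m ⊎ Fin (suc (suc t)))
    A = anchor G Q (suc t)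

    centre : Fin m ⊎ Fin (suc (suc t))
    centre = inj₂ zero

    leaf : Fin (suc t) → Fin m ⊎ Fin (suc (suc t))
    leaf i = inj₂ (suc i)

    Q-Near : ∀ {u v} → u ∈ Q → v ∈ Q → Near G u v
    Q-Near {u} {v} u∈Q v∈Q with u ≟ v
    ... | yes p = inj₁ p
    ... | no ne = inj₂ (proj₁ max u∈Q v∈Q ne)

    absorb : ∀ {x} → (∀ u → u ∈ Q → Near G u x) → x ∈ Q
    absorb {x} near = proj₂ max (Q ∪ ⁅ x ⁆)
      (λ u∈ v∈ u≢v → Near⇒Adj G (clique (x∈p∪q⁻ Q ⁅ x ⁆ u∈) (x∈p∪q⁻ Q ⁅ x ⁆ v∈)) u≢v)
      (x∈p∪q⁺ ∘ inj₁) (x∈p∪q⁺ (inj₂ (x∈⁅x⁆ x)))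
      where
      clique : ∀ {u v} → u ∈ Q ⊎ u ∈ ⁅ x ⁆ → v ∈ Q ⊎ v ∈ ⁅ x ⁆ → Near G u v
      clique (inj₁ p) (inj₁ q) = Q-Near p q
      clique (inj₁ p) (inj₂ q) with refl ← x∈⁅y⁆⇒x≡y x q = near _ p
      clique (inj₂ p) (inj₁ q) with refl ← x∈⁅y⁆⇒x≡y x p = Near-sym G (near _ q)
      clique (inj₂ p) (inj₂ q) with refl ← x∈⁅y⁆⇒x≡y x p | refl ← x∈⁅y⁆⇒x≡y x q = inj₁ refl

    -- This is where cliques of any size must be covered. By maximality, `Q` is then the closed
    -- neighbourhood of the simplicial vertex `s₀`.
    hub : ∃[ s ] (Simplicial G s × (∀ u → u ∈ Q → Near G s u))
    hub = clq (_∈ Q) (_∈? Q) (λ _ _ → Q-Near)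

    s₀ : Fin m
    s₀ = proj₁ hub

    s₀-simplicial : Simplicial G s₀
    s₀-simplicial = proj₁ (proj₂ hub)

    s₀-near : ∀ u → u ∈ Q → Near G s₀ u
    s₀-near = proj₂ (proj₂ hub)

    s₀∈Q : s₀ ∈ Q
    s₀∈Q = absorb λ u u∈Q → Near-sym G (s₀-near u u∈Q)

    old : ∀ {u v} → Near G u v → Near A (inj₁ u) (inj₁ v)
    old = Sum.map₁ (cong inj₁)

    old⁻ : ∀ {u v} → Near A (inj₁ u) (inj₁ v) → Near G u v
    old⁻ = Sum.map₁ inj₁-injective

    centre-old : ∀ {v} → v ∈ Q → Near A centre (inj₁ v)
    centre-old v∈Q = inj₂ (v∈Q , refl)

    centre-leaf : ∀ {i} → Adj A centre (leaf i)
    centre-leaf = inj₁ (refl , λ ())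

    leaf-nbr : ∀ {i p} → Near A (leaf i) p → p ≡ leaf i ⊎ p ≡ centre
    leaf-nbr (inj₁ p) = inj₁ (sym p)
    leaf-nbr {p = inj₁ _} (inj₂ (_ , ()))
    leaf-nbr {p = inj₂ _} (inj₂ (inj₁ (() , _)))
    leaf-nbr {p = inj₂ _} (inj₂ (inj₂ (_ , refl))) = inj₂ refl

    leaf-simplicial : ∀ i → Simplicial A (leaf i)
    leaf-simplicial i u v p q with leaf-nbr p | leaf-nbr q
    ... | inj₁ refl | _         = q
    ... | inj₂ refl | inj₁ refl = Near-sym A p
    ... | inj₂ refl | inj₂ refl = inj₁ refl

    centre-not-simplicial : ¬ Simplicial A centre
    centre-not-simplicial sc with sc (inj₁ s₀) (leaf zero) (centre-old s₀∈Q) (inj₂ centre-leaf)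
    ... | inj₁ ()
    ... | inj₂ (_ , ())

    old-simplicial⁻ : ∀ {w} → Simplicial A (inj₁ w) → Simplicial G w
    old-simplicial⁻ sw u v p q = old⁻ (sw _ _ (old p) (old q))

    -- If `w` lies in `Q`, so does its whole old neighbourhood, by maximality, and the centre is
    -- adjacent to all of it; otherwise nothing changes at `w`.
    old-simplicial : ∀ {w} → Simplicial G w → Simplicial A (inj₁ w)
    old-simplicial {w} sw = go
      where
      absorb-w : ∀ {u} → w ∈ Q → Near G w u → u ∈ Q
      absorb-w w∈Q wu = absorb λ v v∈Q → sw _ _ (Q-Near w∈Q v∈Q) wu

      go : Simplicial A (inj₁ w)
      go (inj₁ u) (inj₁ v) p q = old (sw u v (old⁻ p) (old⁻ q))
      go (inj₁ u) (inj₂ b) p (inj₂ (w∈Q , b≡0)) = inj₂ (absorb-w w∈Q (old⁻ p) , b≡0)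
      go (inj₂ a) (inj₁ v) (inj₂ (w∈Q , a≡0)) q = inj₂ (absorb-w w∈Q (old⁻ q) , a≡0)
      go (inj₂ a) (inj₂ b) (inj₂ (_ , refl)) (inj₂ (_ , refl)) = inj₁ refl

    centre-nbr : ∀ {v} → Adj A centre (inj₁ v) → v ∈ Q
    centre-nbr = proj₁

  -- A leaf in the clique covers it. A clique with the centre but no leaf has its old vertices in
  -- `Q`, and `s₀` covers it. Any other clique is old.
  anchor-cliqueCovered : CliqueCovered A
  anchor-cliqueCovered P P? cl with any? (λ i → P? (leaf i)) | P? centre
  ... | yes (i , p) | _ = leaf i , leaf-simplicial i , λ u q → cl (leaf i) u p q
  ... | no ¬leaf | yes c = inj₁ s₀ , old-simplicial s₀-simplicial , near
    where
    near : ∀ u → P u → Near A (inj₁ s₀) u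
    near (inj₁ u) p with cl centre (inj₁ u) c p
    ... | inj₂ (u∈Q , _) = old (s₀-near u u∈Q)
    near (inj₂ zero)    _ = inj₂ (s₀∈Q , refl)
    near (inj₂ (suc i)) p = contradiction (i , p) ¬leaf
  ... | no ¬leaf | no ¬centre
    with clq (P ∘ inj₁) (P? ∘ inj₁) (λ u v p q → old⁻ (cl _ _ p q))
  ... | z , sz , zP = inj₁ z , old-simplicial sz , near
    where
    near : ∀ u → P u → Near A (inj₁ z) u
    near (inj₁ u) p = old (zP u p)
    near (inj₂ zero)    p = contradiction p ¬centre
    near (inj₂ (suc i)) p = contradiction (i , p) ¬leaf

  anchor-thin : Thin A
  anchor-thin (inj₁ z) (inj₁ w) sz sw p =
    cong inj₁ (thin z w (old-simplicial⁻ sz) (old-simplicial⁻ sw) (old⁻ p))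
  anchor-thin (inj₂ zero) _ sz _ _ = contradiction sz centre-not-simplicial
  anchor-thin (inj₂ (suc i)) w _ sw p with leaf-nbr p
  ... | inj₁ q    = sym q
  ... | inj₂ refl = contradiction sw centre-not-simplicial
  anchor-thin z@(inj₁ _) (inj₂ zero) _ sw _ = contradiction sw centre-not-simplicial
  anchor-thin (inj₁ _) (inj₂ (suc _)) _ _ (inj₂ (_ , ()))

  anchor-separating : Separating A
  anchor-separating (inj₂ (suc i)) z w sz sw xz xw walk with leaf-nbr {i} {z} (inj₂ xz)
  ... | inj₁ refl = contradiction xz (Adj-irrefl A {leaf i} refl)
  ... | inj₂ refl = contradiction sz centre-not-simplicial
  anchor-separating (inj₂ zero) z w sz sw xz xw walk = same z w sz sw xz xw (leaf-invariant walk)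
    where
    -- Without the centre, the old graph and the single leaves are separate parts. Within the old
    -- graph, the clique `Q` has at most one simplicial vertex by `Thin`.
    part : Fin m ⊎ Fin (suc (suc t)) → Maybe (Fin (suc (suc t)))
    part = [ (λ _ → nothing) , just ]′

    edge : ∀ {a b} → Avoiding A centre a b → part a ≡ part b
    edge {inj₁ _} {inj₁ _} _ = refl
    edge {inj₁ _} {inj₂ _} ((_ , refl) , _ , ne) = contradiction refl ne
    edge {inj₂ _} {inj₁ _} ((_ , refl) , ne , _) = contradiction refl ne
    edge {inj₂ _} {inj₂ _} (inj₁ (refl , _) , ne , _) = contradiction refl ne
    edge {inj₂ _} {inj₂ _} (inj₂ (_ , refl) , _ , ne) = contradiction refl ne

    leaf-invariant : ∀ {a b} → Star (Avoiding A centre) a b → part a ≡ part b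
    leaf-invariant = Star.fold (λ a b → part a ≡ part b) (trans ∘ edge) refl

    same : ∀ z w → Simplicial A z → Simplicial A w → Adj A centre z → Adj A centre w →
      part z ≡ part w → z ≡ w
    same (inj₁ z) (inj₁ w) sz sw xz xw _ = cong inj₁
      (thin z w (old-simplicial⁻ sz) (old-simplicial⁻ sw) (Q-Near (centre-nbr xz) (centre-nbr xw)))
    same (inj₂ _) (inj₂ _) _ _ _ _ refl = refl
  anchor-separating (inj₁ x) (inj₂ zero) _ sz _ _ _ _ = contradiction sz centre-not-simplicial
  anchor-separating (inj₁ x) (inj₁ z) (inj₂ zero) _ sw _ _ _ = contradiction sw centre-not-simplicial
  anchor-separating (inj₁ x) (inj₁ z) (inj₁ w) sz sw xz xw walk = cong inj₁
    (sep x z w (old-simplicial⁻ sz) (old-simplicial⁻ sw) xz xw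
      (kleisliStar retract edge walk))
    where
    -- Collapsing the star onto s₀ turns walks of the anchored graph into walks of G.
    retract : Fin m ⊎ Fin (suc (suc t)) → Fin m
    retract = [ id , (λ _ → s₀) ]′

    -- By `Thin`, a vertex with a simplicial neighbour is not simplicial itself.
    s₀≢x : s₀ ≢ x
    s₀≢x refl = Adj⇒≢ G xz (thin _ _ s₀-simplicial (old-simplicial⁻ sz) (inj₂ xz))

    edge : ∀ {a b} → Avoiding A (inj₁ x) a b → Star (Avoiding G x) (retract a) (retract b)
    edge {inj₁ a} {inj₁ b} (e , p , q) = return (e , p ∘ cong inj₁ , q ∘ cong inj₁)
    edge {inj₁ a} {inj₂ _} ((a∈Q , _) , p , _) =
      Near⇒Avoiding G (Near-sym G (s₀-near a a∈Q)) (p ∘ cong inj₁) s₀≢x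
    edge {inj₂ _} {inj₁ b} ((b∈Q , _) , _ , q) =
      Near⇒Avoiding G (s₀-near b b∈Q) s₀≢x (q ∘ cong inj₁)
    edge {inj₂ _} {inj₂ _} _ = ε

FromK₁⇒treelike : {G : Graph (Fin n)} → FromK₁ G → CliqueCovered G × Thin G × Separating G
FromK₁⇒treelike {G = G} (start iso) =
  (λ P _ cl → z₀ , (λ u v _ _ → all-near u v) , λ u _ → all-near z₀ u) ,
  (λ z w _ _ _ → all-eq z w) , λ _ z w _ _ _ _ _ → all-eq z w
  where
  open Transport G K₁ iso
  z₀ : Fin _
  z₀ = from zero

  all-eq : ∀ u v → u ≡ v
  all-eq u v = to-injective (Fin1-eq (to u) (to v))
    where
    Fin1-eq : (i j : Fin 1) → i ≡ j
    Fin1-eq zero zero = refl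

  all-near : ∀ u v → Near G u v
  all-near u v = inj₁ (all-eq u v)
FromK₁⇒treelike {G = H} (step {G = G} fk Q max (suc t) _ iso) =
  let clq , thin , sep = FromK₁⇒treelike fk in
  CliqueCovered-from (anchor-cliqueCovered G clq thin sep Q max t) ,
  Thin-from (anchor-thin G clq thin sep Q max t) ,
  Separating-from (anchor-separating G clq thin sep Q max t)
  where open Transport H (anchor G Q (suc t)) iso

CliqueCovered⇒Covered : (G : Graph (Fin n)) → CliqueCovered G → Covered G
CliqueCovered⇒Covered G clq x y xy with clq (λ u → u ≡ x ⊎ u ≡ y) (λ u → (u ≟ x) ⊎-dec (u ≟ y)) near
  where
  near : ∀ u v → u ≡ x ⊎ u ≡ y → v ≡ x ⊎ v ≡ y → Near G u v
  near u v (inj₁ refl) (inj₁ refl) = inj₁ refl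
  near u v (inj₁ refl) (inj₂ refl) = xy
  near u v (inj₂ refl) (inj₁ refl) = Near-sym G xy
  near u v (inj₂ refl) (inj₂ refl) = inj₁ refl
... | z , sz , zP = z , sz , zP x (inj₁ refl) , zP y (inj₂ refl)

-- Building up by anchorings

FromK₁-resp-≅ : (G : Graph (Fin n)) (H : Graph (Fin m)) → G ≅ H → FromK₁ H → FromK₁ G
FromK₁-resp-≅ G H iso (start iso′) = start (≅-trans G H K₁ iso iso′)
FromK₁-resp-≅ G H iso (step {G = F} fk Q max t 1≤t iso′) =
  step fk Q max t 1≤t (≅-trans G H (anchor F Q t) iso iso′)

induced : Graph V → (W → V) → Graph W
induced G f = record
  { Adj        = λ x y → Adj G (f x) (f y)
  ; Adj?       = λ x y → Adj? G (f x) (f y)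
  ; Adj-sym    = Adj-sym G
  ; Adj-irrefl = λ { refl → Adj-irrefl G refl }
  }

crossing : ∀ {R : Rel V 0ℓ} {P : Pred V 0ℓ} → U.Decidable P → ∀ {x y} → Star R x y → P x → ¬ P y →
  ∃[ a ] ∃[ b ] (R a b × P a × ¬ P b)
crossing P? ε px ¬py = contradiction px ¬py
crossing P? (_◅_ {j = w} r rs) px ¬py with P? w
... | yes pw = crossing P? rs pw ¬py
... | no ¬pw = _ , _ , r , px , ¬pw

lookup-injective : {A : Set} {xs : List A} → Unique xs → ∀ i j →
  List.lookup xs i ≡ List.lookup xs j → i ≡ j
lookup-injective (_ ∷ _)  zero    zero    _ = refl
lookup-injective (x∉ ∷ _) zero    (suc j) p = contradiction p (All.lookup x∉ (∈-lookup j))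
lookup-injective (x∉ ∷ _) (suc i) zero    p = contradiction (sym p) (All.lookup x∉ (∈-lookup i))
lookup-injective (_ ∷ u)  (suc i) (suc j) p = cong suc (lookup-injective u i j p)

module _ (G : Graph (Fin n)) (conn : Connected G) (cov : Covered G) (thin : Thin G)
         (sep : Separating G) where

  -- The image of f is a part of G already built by anchorings; it contains every
  -- simplicial neighbour of each of its vertices.
  record Stage {m} (f : Fin m → Fin n) : Set₁ where
    field
      injective : ∀ {u v} → f u ≡ f v → u ≡ v
      closed    : ∀ u {z} → Simplicial G z → Near G (f u) z → ∃[ v ] f v ≡ z
      joined    : ∀ {x} → (∀ u → f u ≢ x) → ∀ u v → Star (Avoiding G x) (f u) (f v)
      fromK₁    : FromK₁ (induced G f)

  open Stage

  module _ {m} {f : Fin m → Fin n} (st : Stage f) {z₀ : Fin m} {b : Fin n}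
           (b∉ : ∀ u → f u ≢ b) (sz : Simplicial G (f z₀)) (zb : Adj G (f z₀) b) where
    private
      -- The leaves of the new star centred at `b`; `f z₀` is the only simplicial neighbour of `b`
      -- built so far.
      New : Pred (Fin n) 0ℓ
      New s = Simplicial G s × Adj G b s × s ≢ f z₀

      New? : U.Decidable New
      New? s = Simplicial? G s ×-dec Adj? G b s ×-dec ¬? (s ≟ f z₀)

      leaves : List (Fin n)
      leaves = List.filter New? (List.allFin n)

      t : ℕ
      t = List.length leaves

      h : Fin m ⊎ Fin (suc t) → Fin n
      h = [ f , List.lookup (b ∷ leaves) ]′

      leaf-new : ∀ i → New (h (inj₂ (suc i)))
      leaf-new i = proj₂ (∈-filter⁻ New? {xs = List.allFin n} (∈-lookup i))

      new-leaf : ∀ {s} → New s → ∃[ i ] h (inj₂ (suc i)) ≡ s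
      new-leaf {s} new = let s∈ = ∈-filter⁺ New? (∈-allFin s) new in
        Any.index s∈ , sym (lookup-index s∈)

      -- A built `s` would be joined to `f z₀` off `b`, because `b` is not built, and then
      -- `Separating` would give `s ≡ f z₀`.
      new∉ : ∀ u {s} → New s → f u ≢ s
      new∉ u (ss , bs , s≢z) refl =
        s≢z (sym (sep b (f z₀) (f u) sz ss (Adj-sym G zb) bs (joined st b∉ z₀ u)))

      new-far : ∀ u {s} → New s → ¬ Adj G (f u) s
      new-far u new@(ss , _) us = let v , p = closed st u ss (inj₂ us) in new∉ v new p

      b-not-simplicial : ¬ Simplicial G b
      b-not-simplicial sb = Adj⇒≢ G zb (thin _ _ sz sb (inj₂ zb))

      -- By `Thin`, `b` is not simplicial, so it has two simplicial neighbours, and one of them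
      -- differs from `f z₀`.
      1≤t : 1 ≤ t
      1≤t = let z , w , sz , sw , bz , bw , z≢w = ¬Simplicial⇒two G cov b-not-simplicial in
        pick sz sw bz bw z≢w (z ≟ f z₀)
        where
        nonempty : ∀ {s} → New s → 1 ≤ t
        nonempty new = ∈-length (∈-filter⁺ New? (∈-allFin _) new)

        pick : ∀ {z w} → Simplicial G z → Simplicial G w → Adj G b z → Adj G b w → z ≢ w →
          Dec (z ≡ f z₀) → 1 ≤ t
        pick sz _  bz _  _   (no z≢)    = nonempty (sz , bz , z≢)
        pick _  sw _  bw z≢w (yes refl) = nonempty (sw , bw , ≢-sym z≢w)

      Q? : U.Decidable (λ u → Near G (f z₀) (f u))
      Q? u = Near? G (f z₀) (f u)

      Q : Subset m
      Q = ⟦ Q? ⟧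

      -- The closed neighbourhood of a simplicial vertex is a clique, and every clique through that
      -- vertex lies within it.
      Q-maximal : IsMaximalClique (induced G f) Q
      Q-maximal =
        (λ u∈ v∈ u≢v → Near⇒Adj G (sz _ _ (∈⟦⟧⁻ Q? u∈) (∈⟦⟧⁻ Q? v∈)) (u≢v ∘ injective st)) ,
        λ R clique Q⊆R u∈R → ∈⟦⟧⁺ Q? (near R clique (Q⊆R (∈⟦⟧⁺ Q? (inj₁ refl))) u∈R)
        where
        near : ∀ R → IsClique (induced G f) R → z₀ ∈ R → ∀ {u} → u ∈ R → Near G (f z₀) (f u)
        near R clique z₀∈R {u} u∈R with z₀ ≟ u
        ... | yes refl = inj₁ refl
        ... | no ne    = inj₂ (clique z₀∈R u∈R ne)

      K : Graph (Fin m ⊎ Fin (suc t))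
      K = anchor (induced G f) Q t

      -- The simplicial vertex covering this edge is built, by `closed`; were it not `f z₀`, it
      -- would be one of the new leaves.
      b-nbr : ∀ u → Adj G (f u) b → u ∈ Q
      b-nbr u ub = let s , ss , su , sb = cov _ _ (inj₂ ub) in ∈⟦⟧⁺ Q? (go ss su sb)
        where
        go : ∀ {s} → Simplicial G s → Near G s (f u) → Near G s b → Near G (f z₀) (f u)
        go {s} ss su sb = subst (λ s → Near G s (f u)) s≡z su
          where
          s≡z : s ≡ f z₀
          s≡z with s ≟ f z₀ | closed st u ss (Near-sym G su)
          ... | yes p | _ = p
          ... | no ne | v , p = contradiction p
            (new∉ v (ss , Near⇒Adj G (Near-sym G sb) (λ { refl → b-not-simplicial ss }) , ne))

      b-nbr⁻ : ∀ u → u ∈ Q → Adj G (f u) b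
      b-nbr⁻ u u∈Q = Near⇒Adj G (sz _ _ (∈⟦⟧⁻ Q? u∈Q) (inj₂ zb)) (b∉ u)

      adj : ∀ p q → Adj G (h p) (h q) → Adj K p q
      adj (inj₁ u) (inj₁ v) a = a
      adj (inj₁ u) (inj₂ zero) a = b-nbr u a , refl
      adj (inj₁ u) (inj₂ (suc i)) a = contradiction a (new-far u (leaf-new i))
      adj (inj₂ zero) (inj₁ v) a = b-nbr v (Adj-sym G a) , refl
      adj (inj₂ (suc i)) (inj₁ v) a = contradiction (Adj-sym G a) (new-far v (leaf-new i))
      adj (inj₂ zero) (inj₂ zero) a = contradiction a (Adj-irrefl G refl)
      adj (inj₂ zero) (inj₂ (suc j)) a = inj₁ (refl , λ ())
      adj (inj₂ (suc i)) (inj₂ zero) a = inj₂ ((λ ()) , refl)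
      adj (inj₂ (suc i)) (inj₂ (suc j)) a = contradiction a (Adj-irrefl G
        (thin _ _ (proj₁ (leaf-new i)) (proj₁ (leaf-new j)) (inj₂ a)))

      adj⁻ : ∀ p q → Adj K p q → Adj G (h p) (h q)
      adj⁻ (inj₁ u) (inj₁ v) a = a
      adj⁻ (inj₁ u) (inj₂ _) (u∈Q , refl) = b-nbr⁻ u u∈Q
      adj⁻ (inj₂ _) (inj₁ v) (v∈Q , refl) = Adj-sym G (b-nbr⁻ v v∈Q)
      adj⁻ (inj₂ _) (inj₂ zero) (inj₁ (refl , ne)) = contradiction refl ne
      adj⁻ (inj₂ _) (inj₂ (suc j)) (inj₁ (refl , _)) = proj₁ (proj₂ (leaf-new j))
      adj⁻ (inj₂ zero) (inj₂ _) (inj₂ (ne , refl)) = contradiction refl ne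
      adj⁻ (inj₂ (suc i)) (inj₂ _) (inj₂ (_ , refl)) = Adj-sym G (proj₁ (proj₂ (leaf-new i)))

      h-injective : ∀ p q → h p ≡ h q → p ≡ q
      h-injective (inj₁ u) (inj₁ v) p = cong inj₁ (injective st p)
      h-injective (inj₁ u) (inj₂ zero) p = contradiction p (b∉ u)
      h-injective (inj₁ u) (inj₂ (suc j)) p = contradiction p (new∉ u (leaf-new j))
      h-injective (inj₂ zero) (inj₁ v) p = contradiction (sym p) (b∉ v)
      h-injective (inj₂ (suc i)) (inj₁ v) p = contradiction (sym p) (new∉ v (leaf-new i))
      h-injective (inj₂ zero) (inj₂ zero) _ = refl
      h-injective (inj₂ zero) (inj₂ (suc j)) p =
        contradiction p (Adj⇒≢ G (proj₁ (proj₂ (leaf-new j))))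
      h-injective (inj₂ (suc i)) (inj₂ zero) p =
        contradiction (sym p) (Adj⇒≢ G (proj₁ (proj₂ (leaf-new i))))
      h-injective (inj₂ (suc i)) (inj₂ (suc j)) p =
        cong (inj₂ ∘ suc) (lookup-injective (filter⁺ New? (allFin⁺ n)) i j p)

      h-closed : ∀ p {z} → Simplicial G z → Near G (h p) z → ∃[ q ] h q ≡ z
      h-closed (inj₁ u) ss us = let v , p = closed st u ss us in inj₁ v , p
      h-closed (inj₂ zero) {s} ss bs with s ≟ f z₀
      ... | yes p = inj₁ z₀ , sym p
      ... | no ne = let i , p = new-leaf (ss , Near⇒Adj G bs (λ { refl → b-not-simplicial ss }) , ne) in
        inj₂ (suc i) , p
      h-closed (inj₂ (suc i)) ss p = inj₂ (suc i) , thin _ _ (proj₁ (leaf-new i)) ss p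

      h-joined : ∀ {x} → (∀ p → h p ≢ x) → ∀ p → Star (Avoiding G x) (h p) (f z₀)
      h-joined x∉ (inj₁ u) = joined st (x∉ ∘ inj₁) u z₀
      h-joined x∉ (inj₂ zero) = return (Adj-sym G zb , x∉ (inj₂ zero) , x∉ (inj₁ z₀))
      h-joined x∉ (inj₂ (suc i)) =
        (Adj-sym G (proj₁ (proj₂ (leaf-new i))) , x∉ (inj₂ (suc i)) , x∉ (inj₂ zero))
        ◅ h-joined x∉ (inj₂ zero)

      h∘join : ∀ p → h (splitAt m (join m (suc t) p)) ≡ h p
      h∘join p = cong h (splitAt-join m (suc t) p)

    extend : ∃[ t ] Σ (Fin (m + suc t) → Fin n) Stage
    extend = t , h ∘ splitAt m , record
      { injective = λ {u} {v} p → Injection.injective (↔⇒↣ +↔⊎) (h-injective (splitAt m u) (splitAt m v) p)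
      ; closed    = λ u ss us → let q , p = h-closed (splitAt m u) ss us in
                      join m (suc t) q , trans (h∘join q) p
      ; joined    = λ {x} x∉ u v →
                      let x∉h = λ p hp≡x → x∉ (join m (suc t) p) (trans (h∘join p) hp≡x) in
                      h-joined x∉h (splitAt m u) ◅◅ reverse (Avoiding-sym G) (h-joined x∉h (splitAt m v))
      ; fromK₁    = step (fromK₁ st) Q Q-maximal t 1≤t
                      (+↔⊎ , λ x y → mk⇔ (adj (splitAt m x) (splitAt m y)) (adj⁻ (splitAt m x) (splitAt m y)))
      }

  private
    initial : ∀ {z} → Simplicial G z → Stage {1} (λ _ → z)
    initial sz = record
      { injective = λ { {zero} {zero} _ → refl }
      ; closed    = λ _ sw zw → zero , thin _ _ sz sw zw
      ; joined    = λ _ _ _ → ε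
      ; fromK₁    = start (↔-id _ , λ { zero zero → mk⇔
                      (λ a → contradiction a (Adj-irrefl G refl)) (contradiction refl) })
      }

    proceed : ∀ {m} {f : Fin m → Fin n} → Fin m → Stage f → ¬ (∀ v → ∃[ u ] f u ≡ v) →
      ∃[ t ] Σ (Fin (m + suc t) → Fin n) Stage
    proceed {f = f} u₀ st ¬onto = grow (crossing Im? (proj₂ conn (f u₀) v) (u₀ , refl) v∉)
      where
      Im? : U.Decidable (λ v → ∃[ u ] f u ≡ v)
      Im? v = any? λ u → f u ≟ v

      v = proj₁ (¬∀⟶∃¬ n _ Im? ¬onto)
      v∉ = proj₂ (¬∀⟶∃¬ n _ Im? ¬onto)

      grow : ∃[ a ] ∃[ b ] (Adj G a b × (∃[ u ] f u ≡ a) × ¬ (∃[ u ] f u ≡ b)) →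
        ∃[ t ] Σ _ Stage
      -- An edge leaving the built part is covered by a simplicial vertex, which is itself built by
      -- `closed`: this gives `z₀`.
      grow (_ , b , ab , (u , refl) , b∉) with cov (f u) b (inj₂ ab)
      ... | z , sz , zu , zb with closed st u sz (Near-sym G zu)
      ... | z₀ , refl = extend st (λ u p → b∉ (u , p)) sz (Near⇒Adj G zb (λ p → b∉ (z₀ , p)))

    -- The fuel `k` bounds the number of vertices not yet built; each extension adds at least the
    -- centre of its star.
    build : ∀ k {m} {f : Fin m → Fin n} → n ≤ m + k → Fin m → Stage f → FromK₁ G
    build k {m} {f} n≤m+k u₀ st with all? (λ v → any? λ u → f u ≟ v)
    ... | yes onto = FromK₁-resp-≅ G (induced G f)
      (mk↔ₛ′ (proj₁ ∘ onto) f (λ u → injective st (proj₂ (onto (f u)))) (proj₂ ∘ onto) ,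
       λ x y → mk⇔ (subst₂ (Adj G) (sym (proj₂ (onto x))) (sym (proj₂ (onto y))))
                   (subst₂ (Adj G) (proj₂ (onto x)) (proj₂ (onto y))))
      (fromK₁ st)
    ... | no ¬onto with proceed u₀ st ¬onto
    -- With no fuel left, a further extension would embed more than `m` vertices into at most `m`.
    build zero {m} n≤m+0 _ _ | no _ | t , f′ , st′ = contradiction
      (≤-trans (injective⇒≤ (injective st′)) (≤-trans n≤m+0 (≤-reflexive (+-identityʳ m))))
      (m+1+n≰m m)
    build (suc k) {m} n≤m+1+k u₀ _ | no _ | t , f′ , st′ =
      build k (≤-trans n≤m+1+k m+1+k≤) (join m (suc t) (inj₁ u₀)) st′
      where
      m+1+k≤ : m + suc k ≤ m + suc t + k
      m+1+k≤ = ≤-trans (+-monoʳ-≤ m (s≤s (m≤n+m k t))) (≤-reflexive (sym (+-assoc m (suc t) k)))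

  treelike⇒FromK₁ : FromK₁ G
  treelike⇒FromK₁ = let z , sz , _ = cov (proj₁ conn) (proj₁ conn) (inj₁ refl) in
    build n (m≤n+m n 1) zero (initial sz)

-- The exceptional graph K₂ and the equivalence

K₂⇒critical : (G : Graph (Fin n)) → G ≅ K₂ → Connected G × Critical G
K₂⇒critical G iso = connected , Covered⇒In𝒢₂ G covered , λ S ne → inj₁ (disconnects S ne)
  where
  open Transport G K₂ iso

  near : ∀ x y → Near G x y
  near x y with to x ≟ to y
  ... | yes p = inj₁ (to-injective p)
  ... | no ne = Near-from (inj₂ ne)

  connected : Connected G
  connected = from zero , λ x y → Near⇒Star G (near x y)

  covered : Covered G
  covered x y xy = x , (λ u v _ _ → near u v) , inj₁ refl , xy

  two : (i j k : Fin 2) → i ≢ j → i ≢ k → j ≡ k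
  two zero       zero       _          p _ = contradiction refl p
  two zero       _          zero       _ q = contradiction refl q
  two zero       (suc zero) (suc zero) _ _ = refl
  two (suc zero) zero       zero       _ _ = refl
  two (suc zero) (suc zero) _          p _ = contradiction refl p
  two (suc zero) _          (suc zero) _ q = contradiction refl q

  disconnects : (S : EdgeSet G) → NonemptyEdges S → ¬ Connected (G ─ S)
  -- Any first step out of `a` leads to the only other vertex, which is `b`, so it would use the
  -- deleted edge.
  disconnects S (a , b , ab) (_ , walk) with walk a b
  ... | ε = Adj-irrefl G refl (Mem⊆Adj S ab)
  ... | _◅_ {j = c} (ac , ¬ac) _ = ¬ac (subst (Mem S a) (to-injective b≡c) ab)
    where
    b≡c : to b ≡ to c
    b≡c = two (to a) (to b) (to c) (Adj-to (Mem⊆Adj S ab)) (Adj-to ac)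

theorem1p4 : ∀ {n : ℕ} (G : Graph (Fin n)) →
    (Connected G × Critical G) ⇔ (G ≅ K₂ ⊎ (Connected G × FromK₁ G))
theorem1p4 G = mk⇔ only-if if
  where
  only-if : Connected G × Critical G → G ≅ K₂ ⊎ (Connected G × FromK₁ G)
  only-if (conn , crit) = Sum.map₂
    (λ thin → conn , treelike⇒FromK₁ G conn (In𝒢₂⇒Covered G (proj₁ crit)) thin
                       (critical⇒separating G conn crit thin))
    (critical⇒K₂⊎thin G conn crit)

  if : G ≅ K₂ ⊎ (Connected G × FromK₁ G) → Connected G × Critical G
  if (inj₁ iso)         = K₂⇒critical G iso
  if (inj₂ (conn , fk)) = let clq , thin , sep = FromK₁⇒treelike fk in
    conn , treelike⇒critical G conn (CliqueCovered⇒Covered G clq) thin sep
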